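{- Let $d$ be a nonnegative integer and let $$H_1(x)=\sum_{i=1}^k \alpha_i (x+x_i)^d,$$ where $x_1,\ldots,x_k$ are distinct real constants, the $\alpha_i$ are nonzero real constants, and $k \leq (d+2)/4$. If $H_1$ is written in the form $$H_1(x)=\sum_{i=1}^l \beta_i (x+y_i)^{e_i}$$ with real constants $\beta_i,y_i$ and arbitrary nonnegative integers $e_i$ (not bounded by $d$), then $l \geq k$. -}

module Defs where

open import Level using (Level; _⊔_; suc)
open import Data.Nat as ℕ using (ℕ)
open import Data.Fin as F using (Fin)
open import Data.Product using (∃; _×_)
open import Relation.Nullary using (¬_)
open import Relation.Unary using (Pred)
open import Algebra.Bundles using (CommutativeRing)
open import Relation.Binary.Structures using (IsTotalOrder)

-- An axiomatic model of the real numbers: a Dedekind-complete ordered field.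
-- (Classically, any such structure is isomorphic to ℝ.)
record RealField (c ℓ : Level) : Set (Level.suc (c ⊔ ℓ)) where
  field
    commRing : CommutativeRing c ℓ
  open CommutativeRing commRing public
  field
    _≤_            : Carrier → Carrier → Set ℓ
    ≤-isTotalOrder : IsTotalOrder _≈_ _≤_
    0≉1            : ¬ (0# ≈ 1#)
    inverse        : ∀ x → ¬ (x ≈ 0#) → ∃ λ y → (x * y) ≈ 1#
    +-mono-≤       : ∀ {x y} z → x ≤ y → (x + z) ≤ (y + z)
    *-nonneg       : ∀ {x y} → 0# ≤ x → 0# ≤ y → 0# ≤ (x * y)
    complete       : (P : Pred Carrier (c ⊔ ℓ)) → ∃ P →
                     (∃ λ b → ∀ x → P x → x ≤ b) →
                     ∃ λ s → (∀ x → P x → x ≤ s) ×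
                             (∀ b → (∀ x → P x → x ≤ b) → s ≤ b)

module _ {c ℓ : Level} (R : CommutativeRing c ℓ) where
  open CommutativeRing R using (Carrier; _+_; _*_; 0#; 1#)

  pow : Carrier → ℕ → Carrier
  pow x ℕ.zero    = 1#
  pow x (ℕ.suc n) = x * pow x n

  sumFin : (n : ℕ) → (Fin n → Carrier) → Carrier
  sumFin ℕ.zero    f = 0#
  sumFin (ℕ.suc n) f = f F.zero + sumFin n (λ i → f (F.suc i))

{-# OPTIONS --safe #-}

-- Move everything to one side, getting N = k + l terms cᵢ (x - aᵢ)^eᵢ whose sum
-- vanishes.  If l < k then 2 N ≤ d, and some term of exponent d on the left is
-- the only one with its exponent and node.  Let z run from -∞ to +∞ and follow
-- the vector v(z) of Taylor coefficients at z, up to order n, of the sum of the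
-- terms with aᵢ ≤ z, where n ≥ d is the top exponent.  This vector is zero at both
-- ends.  Between nodes it undergoes a Taylor shift, which increases neither its
-- weak nor its strong number of sign variations (zeros being given the signs that
-- minimise, respectively maximise, the variations); moreover, when its last
-- coordinate is nonzero, the strong number after a shift by h > 0 is at most the
-- weak number before it.  Passing a node changes one coordinate per term, hence
-- the variations by at most 2.  The weak number for the zero vector is 0 and the
-- strong one is n + 1 (counted after a fixed initial sign), so if the last
-- coordinate were ever nonzero between two nodes, n + 1 ≤ 2 N ≤ d would follow.
-- Hence, at each node, the coefficients of the terms of exponent n sum to zero.
-- Removing these terms, one descends to n = d, which contradicts the isolated term.
module Submission where

open import Defs
open import Algebra.Bundles using (CommutativeRing)
import Algebra.Properties.AbelianGroup as AbelianGroupProperties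
import Algebra.Properties.Ring as RingProperties
import Algebra.Solver.Ring.NaturalCoefficients.Default as SemiringSolver
open import Data.Fin using (Fin)
open import Data.Fin.Base using (zero; suc; fromℕ)
import Data.Fin.Properties as Finₚ
open import Data.List.Base using (List; []; _∷_; _++_; filter; length; tabulate)
open import Data.List.Membership.Propositional using (find; lose)
open import Data.List.Properties using (filter-notAll; length-++; length-tabulate)
open import Data.List.Relation.Binary.Permutation.Propositional as ↭ using (_↭_; ↭-sym)
open import Data.List.Relation.Binary.Permutation.Propositional.Properties using (All-resp-↭; ↭-length)
open import Data.List.Relation.Unary.All as Listₐ using ([]; _∷_) renaming (All to Allₗ)
open import Data.List.Relation.Unary.All.Properties using (¬Any⇒All¬; filter⁺)
open import Data.List.Relation.Unary.Any using (any?)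
open import Data.List.Relation.Unary.Linked using (Linked; []; [-]; _∷_)
import Data.List.Sort as Sort
open import Data.Nat as ℕ using (ℕ; zero; suc; s≤s; z≤n)
import Data.Nat.Properties as ℕₚ
open import Data.Nat.Tactic.RingSolver using (solve-∀)
open import Data.Product using (∃; _×_; _,_; proj₁; proj₂)
open import Data.Sign.Base using (Sign; opposite) renaming (+ to ⊕; - to ⊖)
open import Data.Sum as Sum using (_⊎_; inj₁; inj₂; swap)
open import Data.Vec.Base using (Vec; []; _∷_; replicate; lookup)
open import Data.Vec.Relation.Binary.Pointwise.Inductive using (Pointwise; []; _∷_)
open import Data.Vec.Relation.Unary.All using (All; []; _∷_)
open import Function.Base using (_∘_)
open import Level as Level using (Level; _⊔_; Lift; lift; lower)
open import Relation.Binary.Bundles using (DecTotalOrder)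
import Relation.Binary.Construct.Flip.EqAndOrd as Flip
import Relation.Binary.Construct.On as On
open import Relation.Binary.PropositionalEquality as ≡ using (_≡_)
import Relation.Binary.Reasoning.Setoid as SetoidReasoning
open import Relation.Binary.Structures using (IsEquivalence; IsTotalOrder; IsDecTotalOrder)
open import Relation.Nullary using (¬_; ¬?; Dec; yes; no; contradiction; _×-dec_)
open import Relation.Nullary.Decidable using (decidable-stable)
open import Relation.Nullary.Negation using (¬¬-map)

-- Sign vectors and their variations.

sameOrOpposite : ∀ s t → s ≡ t ⊎ s ≡ opposite t
sameOrOpposite ⊕ ⊕ = inj₁ ≡.refl
sameOrOpposite ⊕ ⊖ = inj₂ ≡.refl
sameOrOpposite ⊖ ⊕ = inj₂ ≡.refl
sameOrOpposite ⊖ ⊖ = inj₁ ≡.refl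

change : Sign → Sign → ℕ
change ⊕ ⊕ = 0
change ⊕ ⊖ = 1
change ⊖ ⊕ = 1
change ⊖ ⊖ = 0

change-refl : ∀ s → change s s ≡ 0
change-refl ⊕ = ≡.refl
change-refl ⊖ = ≡.refl

change-opposite : ∀ s → change s (opposite s) ≡ 1
change-opposite ⊕ = ≡.refl
change-opposite ⊖ = ≡.refl

change≤1 : ∀ s t → change s t ℕ.≤ 1
change≤1 ⊕ ⊕ = z≤n
change≤1 ⊕ ⊖ = s≤s z≤n
change≤1 ⊖ ⊕ = s≤s z≤n
change≤1 ⊖ ⊖ = z≤n

change-triangle : ∀ s t u → change s u ℕ.≤ change s t ℕ.+ change t u
change-triangle ⊕ ⊕ u = ℕₚ.≤-refl
change-triangle ⊖ ⊖ u = ℕₚ.≤-refl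
change-triangle ⊕ ⊖ u = ℕₚ.≤-trans (change≤1 ⊕ u) (s≤s z≤n)
change-triangle ⊖ ⊕ u = ℕₚ.≤-trans (change≤1 ⊖ u) (s≤s z≤n)

-- Counting after a start sign `s` lets inductions hand the sign of the head to the tail, and allows
-- a vector of length `n` up to `n` variations.
variations : ∀ {n} → Sign → Vec Sign n → ℕ
variations s []      = 0
variations s (t ∷ σ) = change s t ℕ.+ variations t σ

variations-start : ∀ {n} s t (σ : Vec Sign n) → variations s σ ℕ.≤ change s t ℕ.+ variations t σ
variations-start s t []      = z≤n
variations-start s t (u ∷ σ) = begin
  change s u ℕ.+ variations u σ                     ≤⟨ ℕₚ.+-monoˡ-≤ _ (change-triangle s t u) ⟩
  change s t ℕ.+ change t u ℕ.+ variations u σ      ≡⟨ ℕₚ.+-assoc (change s t) _ _ ⟩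
  change s t ℕ.+ (change t u ℕ.+ variations u σ)    ∎
  where open ℕₚ.≤-Reasoning

-- An entry takes part in only two comparisons, with its predecessor and its successor.
variations-head : ∀ {n} s t u (σ : Vec Sign n) → variations s (t ∷ σ) ℕ.≤ 2 ℕ.+ variations s (u ∷ σ)
variations-head s t u σ = begin
  change s t ℕ.+ variations t σ                     ≤⟨ ℕₚ.+-mono-≤ (change≤1 s t) (variations-start t u σ) ⟩
  1 ℕ.+ (change t u ℕ.+ variations u σ)             ≤⟨ ℕₚ.+-monoʳ-≤ 1 (ℕₚ.+-monoˡ-≤ _ (change≤1 t u)) ⟩
  2 ℕ.+ variations u σ                              ≤⟨ ℕₚ.+-monoʳ-≤ 2 (ℕₚ.m≤n+m _ (change s u)) ⟩
  2 ℕ.+ variations s (u ∷ σ)                        ∎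
  where open ℕₚ.≤-Reasoning

alternating : Sign → (n : ℕ) → Vec Sign n
alternating s zero    = []
alternating s (suc n) = opposite s ∷ alternating (opposite s) n

variations-alternating : ∀ s n → variations s (alternating s n) ≡ n
variations-alternating s zero    = ≡.refl
variations-alternating s (suc n) = ≡.cong₂ ℕ._+_ (change-opposite s) (variations-alternating (opposite s) n)

variations-replicate : ∀ s n → variations s (replicate n s) ≡ 0
variations-replicate s zero    = ≡.refl
variations-replicate s (suc n) = ≡.cong₂ ℕ._+_ (change-refl s) (variations-replicate s n)

-- Isolates what the sign argument uses; the reals qualify once equality and order are doubly
-- negated, which makes both decidable.
record DiscreteOrderedDomain (c ℓ : Level) : Set (Level.suc (c ⊔ ℓ)) where
  field
    commRing : CommutativeRing c ℓ
  open CommutativeRing commRing public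
  infix 4 _≤_
  field
    _≤_             : Carrier → Carrier → Set ℓ
    isDecTotalOrder : IsDecTotalOrder _≈_ _≤_
    0≉1             : ¬ (0# ≈ 1#)
    x*y≈0⇒y≈0       : ∀ {x y} → ¬ (x ≈ 0#) → x * y ≈ 0# → y ≈ 0#
    +-mono-≤        : ∀ {x y} z → x ≤ y → x + z ≤ y + z
    *-nonneg        : ∀ {x y} → 0# ≤ x → 0# ≤ y → 0# ≤ x * y

module ShiftedPowers {c ℓ : Level} (K : DiscreteOrderedDomain c ℓ) where
  open DiscreteOrderedDomain K hiding (zero)
  open IsDecTotalOrder isDecTotalOrder
    using (_≟_; _≤?_; total; antisym; ≤-respˡ-≈; ≤-respʳ-≈)
    renaming (refl to ≤-refl; trans to ≤-trans; reflexive to ≤-reflexive)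
  open RingProperties ring using (-0#≈0#; -‿involutive; -‿+-comm; -‿distribˡ-*; -‿distribʳ-*)
  open AbelianGroupProperties +-abelianGroup using (xyx⁻¹≈y)
  open SemiringSolver commutativeSemiring using (solve; con; _:+_; _:*_; _:=_)

  -- Ordered arithmetic and signs of elements.

  decTotalOrder : DecTotalOrder c ℓ ℓ
  decTotalOrder = record { isDecTotalOrder = isDecTotalOrder }

  0≤x+y : ∀ {x y} → 0# ≤ x → 0# ≤ y → 0# ≤ x + y
  0≤x+y {x} {y} 0≤x 0≤y = ≤-trans 0≤y (≤-respˡ-≈ (+-identityˡ y) (+-mono-≤ y 0≤x))

  x≤y⇒0≤y-x : ∀ {x y} → x ≤ y → 0# ≤ y - x
  x≤y⇒0≤y-x {x} x≤y = ≤-respˡ-≈ (-‿inverseʳ x) (+-mono-≤ (- x) x≤y)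

  [y-x]+x≈y : ∀ x y → (y - x) + x ≈ y
  [y-x]+x≈y x y = trans (+-assoc y (- x) x) (trans (+-congˡ (-‿inverseˡ x)) (+-identityʳ y))

  0≤y-x⇒x≤y : ∀ {x y} → 0# ≤ y - x → x ≤ y
  0≤y-x⇒x≤y {x} {y} p = ≤-respˡ-≈ (+-identityˡ x) (≤-respʳ-≈ ([y-x]+x≈y x y) (+-mono-≤ x p))

  x≤0⇒0≤-x : ∀ {x} → x ≤ 0# → 0# ≤ - x
  x≤0⇒0≤-x x≤0 = ≤-respʳ-≈ (+-identityˡ _) (x≤y⇒0≤y-x x≤0)

  0≤-x⇒x≤0 : ∀ {x} → 0# ≤ - x → x ≤ 0#
  0≤-x⇒x≤0 p = 0≤y-x⇒x≤y (≤-respʳ-≈ (sym (+-identityˡ _)) p)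

  -- Zero is allowed both signs, so that the least (greatest) number of
  -- variations among the sign vectors agreeing with v is the weak
  -- (strong) number of sign variations of v.
  Agrees : Sign → Carrier → Set ℓ
  Agrees ⊕ x = 0# ≤ x
  Agrees ⊖ x = 0# ≤ - x

  Signs : ∀ {n} → Vec Sign n → Vec Carrier n → Set (c ⊔ ℓ)
  Signs = Pointwise Agrees

  agrees-resp : ∀ s {x y} → x ≈ y → Agrees s x → Agrees s y
  agrees-resp ⊕ x≈y = ≤-respʳ-≈ x≈y
  agrees-resp ⊖ x≈y = ≤-respʳ-≈ (-‿cong x≈y)

  agrees-total : ∀ s x → Agrees s x ⊎ Agrees (opposite s) x
  agrees-total ⊕ x with total 0# x
  ... | inj₁ 0≤x = inj₁ 0≤x
  ... | inj₂ x≤0 = inj₂ (x≤0⇒0≤-x x≤0)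
  agrees-total ⊖ x = swap (agrees-total ⊕ x)

  agrees-some : ∀ x → ∃ λ s → Agrees s x
  agrees-some x with agrees-total ⊕ x
  ... | inj₁ p = ⊕ , p
  ... | inj₂ p = ⊖ , p

  agrees-zero : ∀ s {x} → x ≈ 0# → Agrees s x
  agrees-zero ⊕ x≈0 = ≤-reflexive (sym x≈0)
  agrees-zero ⊖ x≈0 = ≤-reflexive (sym (trans (-‿cong x≈0) -0#≈0#))

  agrees-neg : ∀ s {x} → Agrees s x → Agrees (opposite s) (- x)
  agrees-neg ⊕ p = ≤-respʳ-≈ (sym (-‿involutive _)) p
  agrees-neg ⊖ p = p

  agrees-both : ∀ s {x} → Agrees s x → Agrees (opposite s) x → x ≈ 0#
  agrees-both ⊕ p q = antisym (0≤-x⇒x≤0 q) p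
  agrees-both ⊖ p q = antisym (0≤-x⇒x≤0 p) q

  agrees-+ : ∀ s {x y} → Agrees s x → Agrees s y → Agrees s (x + y)
  agrees-+ ⊕ p q = 0≤x+y p q
  agrees-+ ⊖ p q = ≤-respʳ-≈ (-‿+-comm _ _) (0≤x+y p q)

  agrees-* : ∀ s {h x} → 0# ≤ h → Agrees s x → Agrees s (h * x)
  agrees-* ⊕ 0≤h p = *-nonneg 0≤h p
  agrees-* ⊖ 0≤h p = ≤-respʳ-≈ (sym (-‿distribʳ-* _ _)) (*-nonneg 0≤h p)

  -- If `x` had the opposite sign, so would `h * x`, which would then agree with both signs and
  -- vanish; cancelling `h` leaves `x ≈ 0#`, which agrees with every sign.
  agrees-*-cancel : ∀ s {h x} → ¬ (h ≤ 0#) → Agrees s (h * x) → Agrees s x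
  agrees-*-cancel s {h} {x} h≰0 p with total 0# h | agrees-total s x
  ... | inj₂ h≤0 | _      = contradiction h≤0 h≰0
  ... | inj₁ _   | inj₁ q = q
  ... | inj₁ 0≤h | inj₂ q = agrees-zero s
    (x*y≈0⇒y≈0 (h≰0 ∘ ≤-reflexive) (agrees-both s p (agrees-* (opposite s) 0≤h q)))

  agrees-shift : ∀ s {h x y} → 0# ≤ h → Agrees s x → Agrees s y → Agrees s (x + h * y)
  agrees-shift s 0≤h p q = agrees-+ s p (agrees-* s 0≤h q)

  agrees-unshift : ∀ s {h x y} → 0# ≤ h →
                   Agrees (opposite s) (x + h * y) → Agrees s y → Agrees (opposite s) x
  agrees-unshift s {h} {x} {y} 0≤h p q = agrees-resp (opposite s)
    (trans (+-congʳ (+-comm x (h * y))) (xyx⁻¹≈y (h * y) x))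
    (agrees-+ (opposite s) p (agrees-neg s (agrees-* s 0≤h q)))

  -- A change of sign from `x` to `x + h * y` must be caused by the difference `h * y`, hence by
  -- `y`.
  agrees-increment : ∀ s {h x y} → ¬ (h ≤ 0#) →
                     Agrees s x → Agrees (opposite s) (x + h * y) → Agrees (opposite s) y
  agrees-increment s {h} {x} {y} h≰0 p q = agrees-*-cancel (opposite s) h≰0
    (agrees-resp (opposite s) (xyx⁻¹≈y x (h * y)) (agrees-+ (opposite s) q (agrees-neg s p)))

  -- Polynomials as coefficient vectors, and the Taylor shift.

  eval : ∀ {n} → Vec Carrier n → Carrier → Carrier
  eval []      y = 0#
  eval (x ∷ v) y = x + y * eval v y

  eval-cong : ∀ {n} (v : Vec Carrier n) {y z} → y ≈ z → eval v y ≈ eval v z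
  eval-cong []      y≈z = refl
  eval-cong (x ∷ v) y≈z = +-congˡ (*-cong y≈z (eval-cong v y≈z))

  leading : ∀ {n} → Vec Carrier (suc n) → Carrier
  leading {n} v = lookup v (fromℕ n)

  -- Coefficients are listed from the constant term on. Applied to `x ∷ v`, this gives the
  -- coefficients of `x + (Y + h) * v(Y)`, so that `shift` is Horner's scheme for `v(Y + h)`. When
  -- `h` is nonnegative, each entry only gains a nonnegative multiple of its right neighbour.
  horner : ∀ {n} → Carrier → Vec Carrier n → Vec Carrier n
  horner h []          = []
  horner h (x ∷ [])    = x ∷ []
  horner h (x ∷ y ∷ v) = x + h * y ∷ horner h (y ∷ v)

  shift : ∀ {n} → Carrier → Vec Carrier n → Vec Carrier n
  shift h []      = []
  shift h (x ∷ v) = horner h (x ∷ shift h v)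

  eval-horner : ∀ {n} h x (v : Vec Carrier n) y →
                eval (horner h (x ∷ v)) y ≈ x + (y + h) * eval v y
  eval-horner h x []      y = +-congˡ (trans (zeroʳ y) (sym (zeroʳ (y + h))))
  eval-horner h x (z ∷ v) y = trans (+-congˡ (*-congˡ (eval-horner h z v y)))
    (solve 5 (λ h x z y e → (x :+ h :* z) :+ y :* (z :+ (y :+ h) :* e)
                         := x :+ (y :+ h) :* (z :+ y :* e))
       refl h x z y (eval v y))

  eval-shift : ∀ {n} h (v : Vec Carrier n) y → eval (shift h v) y ≈ eval v (y + h)
  eval-shift h []      y = refl
  eval-shift h (x ∷ v) y =
    trans (eval-horner h x (shift h v) y) (+-congˡ (*-congˡ (eval-shift h v y)))

  leading-horner : ∀ {n} h (v : Vec Carrier (suc n)) → leading (horner h v) ≡ leading v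
  leading-horner h (x ∷ [])    = ≡.refl
  leading-horner h (x ∷ y ∷ v) = leading-horner h (y ∷ v)

  leading-shift : ∀ {n} h (v : Vec Carrier (suc n)) → leading (shift h v) ≡ leading v
  leading-shift h (x ∷ [])    = ≡.refl
  leading-shift h (x ∷ y ∷ v) =
    ≡.trans (leading-horner h (x ∷ shift h (y ∷ v))) (leading-shift h (y ∷ v))

  horner-zero : ∀ {n} h (v : Vec Carrier n) → All (_≈ 0#) (horner h v) → All (_≈ 0#) v
  horner-zero h []          zs       = zs
  horner-zero h (x ∷ [])    zs       = zs
  horner-zero h (x ∷ y ∷ v) (z ∷ zs) with horner-zero h (y ∷ v) zs
  ... | y≈0 ∷ v≈0 = x≈0 ∷ y≈0 ∷ v≈0
    where
    x≈0 : x ≈ 0#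
    x≈0 = trans (sym (trans (+-congˡ (trans (*-congˡ y≈0) (zeroʳ h))) (+-identityʳ x))) z

  shift-zero : ∀ {n} h (v : Vec Carrier n) → All (_≈ 0#) (shift h v) → All (_≈ 0#) v
  shift-zero h []      zs = []
  shift-zero h (x ∷ v) zs with horner-zero h (x ∷ shift h v) zs
  ... | x≈0 ∷ v≈0 = x≈0 ∷ shift-zero h v v≈0

  -- Polynomials vanishing at all positive points.

  0≤1 : 0# ≤ 1#
  0≤1 with total 0# 1#
  ... | inj₁ p = p
  ... | inj₂ p = ≤-respʳ-≈ (trans (sym (-‿distribʳ-* _ _)) (trans (-‿cong (*-identityʳ _)) (-‿involutive 1#)))
                   (*-nonneg (x≤0⇒0≤-x p) (x≤0⇒0≤-x p))

  x+1≰x : ∀ x → ¬ (x + 1# ≤ x)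
  x+1≰x x p = 0≉1 (antisym 0≤1 (0≤-x⇒x≤0 (≤-respʳ-≈ (x-[x+1]≈-1) (x≤y⇒0≤y-x p))))
    where
    x-[x+1]≈-1 : x - (x + 1#) ≈ - 1#
    x-[x+1]≈-1 = trans (+-congˡ (sym (-‿+-comm x 1#)))
      (trans (sym (+-assoc x (- x) (- 1#))) (trans (+-congʳ (-‿inverseʳ x)) (+-identityˡ _)))

  -- Shifting by 1 moves the root 1 to 0, where it can be divided out.
  vanishing⇒zero : ∀ {n} (v : Vec Carrier n) →
                   (∀ y → ¬ (y ≤ 0#) → eval v y ≈ 0#) → All (_≈ 0#) v
  vanishing⇒zero []          eval≈0 = []
  vanishing⇒zero v@(_ ∷ _) eval≈0 = shift-zero 1# v (zeros (shift 1# v) λ y 0≤y →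
      trans (eval-shift 1# v y) (eval≈0 (y + 1#) λ y+1≤0 → x+1≰x y (≤-trans y+1≤0 0≤y)))
    where
    zeros : ∀ {n} (w : Vec Carrier (suc n)) → (∀ y → 0# ≤ y → eval w y ≈ 0#) → All (_≈ 0#) w
    -- The constant term is read off at 0. Dividing the rest by `y` loses the point 0, which is why
    -- only positive points are assumed in the recursion.
    zeros (x ∷ w) w≈0 = x≈0 ∷ vanishing⇒zero w λ y y≰0 → x*y≈0⇒y≈0 (y≰0 ∘ ≤-reflexive)
        (trans (sym (trans (+-congʳ x≈0) (+-identityˡ _))) (w≈0 y (0≤y y≰0)))
      where
      x≈0 : x ≈ 0#
      x≈0 = trans (sym (trans (+-congˡ (zeroˡ _)) (+-identityʳ x))) (w≈0 0# ≤-refl)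
      0≤y : ∀ {y} → ¬ (y ≤ 0#) → 0# ≤ y
      0≤y {y} y≰0 with total 0# y
      ... | inj₁ p = p
      ... | inj₂ p = contradiction p y≰0

  -- Sign variations under a Taylor shift.

  AgreeingWithin : ∀ {n} → Vec Carrier n → Sign → ℕ → Set (c ⊔ ℓ)
  AgreeingWithin v s m = ∃ λ σ → Signs σ v × variations s σ ℕ.≤ m

  -- A witness here bounds the strong number of variations from below, as one for `AgreeingWithin`
  -- bounds the weak number from above; neither extremum is ever computed.
  AgreeingBeyond : ∀ {n} → Vec Carrier n → Sign → ℕ → Set (c ⊔ ℓ)
  AgreeingBeyond v s m = ∃ λ σ → Signs σ v × m ℕ.≤ variations s σ

  -- If `t` and `u` are equal, the sum keeps that sign. Otherwise it has one of the two signs: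
  -- keeping `t` changes nothing, and moving to `u` merely skips the detour from `s` through `t`.
  shifted-sign : ∀ s {t u h x y} → 0# ≤ h → Agrees t x → Agrees u y →
                 ∃ λ t′ → Agrees t′ (x + h * y) × change s t′ ℕ.+ change t′ u ℕ.≤ change s t ℕ.+ change t u
  shifted-sign s {t} {u} {h} {x} {y} 0≤h p q with sameOrOpposite t u
  ... | inj₁ ≡.refl = t , agrees-shift t 0≤h p q , ℕₚ.≤-refl
  ... | inj₂ ≡.refl with agrees-total u (x + h * y)
  ...   | inj₂ p′ = t , p′ , ℕₚ.≤-refl
  ...   | inj₁ p′ = u , p′ , (begin
    change s u ℕ.+ change u u    ≡⟨ ≡.cong (change s u ℕ.+_) (change-refl u) ⟩
    change s u ℕ.+ 0             ≡⟨ ℕₚ.+-identityʳ _ ⟩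
    change s u                   ≤⟨ change-triangle s t u ⟩
    change s t ℕ.+ change t u    ∎)
    where open ℕₚ.≤-Reasoning

  horner-weak : ∀ {n} {h} → 0# ≤ h → ∀ s (v : Vec Carrier n) {σ} → Signs σ v →
                AgreeingWithin (horner h v) s (variations s σ)
  horner-weak 0≤h s []          []            = [] , [] , z≤n
  horner-weak 0≤h s (x ∷ [])    (p ∷ [])      = _ , p ∷ [] , ℕₚ.≤-refl
  horner-weak 0≤h s (x ∷ y ∷ v) {t ∷ u ∷ τ} (p ∷ q ∷ r)
    -- The tail is bounded after every start sign, because it will follow the new sign `t′` rather
    -- than `t`.
    with ih ← (λ t′ → horner-weak 0≤h t′ (y ∷ v) (q ∷ r))
    with t′ , p′ , le ← shifted-sign s 0≤h p q
    with σ′ , r′ , le′ ← ih t′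
    = t′ ∷ σ′ , p′ ∷ r′ , (begin
      change s t′ ℕ.+ variations t′ σ′                       ≤⟨ ℕₚ.+-monoʳ-≤ (change s t′) le′ ⟩
      change s t′ ℕ.+ (change t′ u ℕ.+ variations u τ)       ≡⟨ ℕₚ.+-assoc (change s t′) _ _ ⟨
      change s t′ ℕ.+ change t′ u ℕ.+ variations u τ         ≤⟨ ℕₚ.+-monoˡ-≤ _ le ⟩
      change s t ℕ.+ change t u ℕ.+ variations u τ           ≡⟨ ℕₚ.+-assoc (change s t) _ _ ⟩
      change s t ℕ.+ (change t u ℕ.+ variations u τ)         ∎)
    where open ℕₚ.≤-Reasoning

  shift-weak : ∀ {n} {h} → 0# ≤ h → ∀ s (v : Vec Carrier n) {σ} → Signs σ v →
               AgreeingWithin (shift h v) s (variations s σ)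
  shift-weak 0≤h s []      []      = [] , [] , z≤n
  shift-weak {h = h} 0≤h s (x ∷ v) {t ∷ σ} (p ∷ r)
    with σ₁ , r₁ , le₁ ← shift-weak 0≤h t v r
    with σ₂ , r₂ , le₂ ← horner-weak 0≤h s (x ∷ shift h v) (p ∷ r₁)
    = σ₂ , r₂ , ℕₚ.≤-trans le₂ (ℕₚ.+-monoʳ-≤ (change s t) le₁)

  -- Signs for the original vector are found from right to left, `x` keeping the sign `t` of
  -- `x + h * y` where possible. Where not, `y` was given the sign `t` as well, since otherwise `x`
  -- would agree with `t`; so the opposite sign of `x` is inserted before a `t`, which loses no
  -- variations.
  horner-strong : ∀ {n} {h} → 0# ≤ h → ∀ s (v : Vec Carrier n) {σ} → Signs σ (horner h v) →
                  AgreeingBeyond v s (variations s σ)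
  horner-strong 0≤h s []          []            = [] , [] , z≤n
  horner-strong 0≤h s (x ∷ [])    (p ∷ [])      = _ , p ∷ [] , ℕₚ.≤-refl
  horner-strong {h = h} 0≤h s (x ∷ y ∷ v) {t ∷ σ} (p ∷ r)
    with horner-strong 0≤h t (y ∷ v) r
  ... | u ∷ τ , q ∷ r′ , le = go (agrees-total t x) (sameOrOpposite t u)
    where
    open ℕₚ.≤-Reasoning
    keep : Agrees t x → AgreeingBeyond (x ∷ y ∷ v) s (variations s (t ∷ σ))
    keep p′ = t ∷ u ∷ τ , p′ ∷ q ∷ r′ , ℕₚ.+-monoʳ-≤ (change s t) le
    go : Agrees t x ⊎ Agrees (opposite t) x → t ≡ u ⊎ t ≡ opposite u →
         AgreeingBeyond (x ∷ y ∷ v) s (variations s (t ∷ σ))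
    go (inj₁ p′) _             = keep p′
    go (inj₂ p′) (inj₂ ≡.refl) = keep (agrees-unshift u 0≤h p q)
    go (inj₂ p′) (inj₁ ≡.refl) = opposite t ∷ t ∷ τ , p′ ∷ q ∷ r′ , (begin
      change s t ℕ.+ variations t σ                    ≤⟨ ℕₚ.+-monoʳ-≤ (change s t) le ⟩
      change s t ℕ.+ (change t t ℕ.+ variations t τ)   ≡⟨ ≡.cong (λ a → change s t ℕ.+ (a ℕ.+ variations t τ)) (change-refl t) ⟩
      variations s (t ∷ τ)                             ≤⟨ variations-start s (opposite t) (t ∷ τ) ⟩
      variations s (opposite t ∷ t ∷ τ)                ∎)

  shift-strong : ∀ {n} {h} → 0# ≤ h → ∀ s (v : Vec Carrier n) {σ} → Signs σ (shift h v) →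
                 AgreeingBeyond v s (variations s σ)
  shift-strong 0≤h s []      []      = [] , [] , z≤n
  shift-strong {h = h} 0≤h s (x ∷ v) r
    with t ∷ σ₁ , p ∷ r₁ , le₁ ← horner-strong 0≤h s (x ∷ shift h v) r
    with σ₂ , r₂ , le₂ ← shift-strong 0≤h t v r₁
    = t ∷ σ₂ , p ∷ r₂ , ℕₚ.≤-trans le₁ (ℕₚ.+-monoʳ-≤ (change s t) le₂)

  -- Here the sign `t` of `x` is prescribed. If `σ` starts with `t`, the recursion continues with
  -- any sign of `y`. If it starts with the opposite sign, the positive multiple of `y` caused the
  -- change, so `y` has that sign, and inserting `t` before it loses nothing. A nonzero last entry
  -- has only one sign, which closes the recursion.
  horner-strict : ∀ {n} {h} → ¬ (h ≤ 0#) → ∀ s x (v : Vec Carrier n) → ¬ (leading (x ∷ v) ≈ 0#) →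
                  ∀ {t σ} → Agrees t x → Signs σ (horner h (x ∷ v)) →
                  ∃ λ τ → Signs τ v × variations s σ ℕ.≤ variations s (t ∷ τ)
  horner-strict h≰0 s x [] x≉0 {t} {t′ ∷ []} p (p′ ∷ []) with sameOrOpposite t′ t
  ... | inj₁ ≡.refl = [] , [] , ℕₚ.≤-refl
  ... | inj₂ ≡.refl = contradiction (agrees-both t p p′) x≉0
  horner-strict {h = h} h≰0 s x (y ∷ v) lead≉0 {t} {t′ ∷ σ} p (p′ ∷ r) = go (sameOrOpposite t′ t)
    where
    open ℕₚ.≤-Reasoning
    go : t′ ≡ t ⊎ t′ ≡ opposite t →
         ∃ λ τ → Signs τ (y ∷ v) × variations s (t′ ∷ σ) ℕ.≤ variations s (t ∷ τ)
    go (inj₁ ≡.refl)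
      with u , q ← agrees-some y
      with τ , r′ , le ← horner-strict h≰0 t y v lead≉0 q r
      = u ∷ τ , q ∷ r′ , ℕₚ.+-monoʳ-≤ (change s t) le
    go (inj₂ ≡.refl)
      with q ← agrees-increment t h≰0 p p′
      with τ , r′ , le ← horner-strict h≰0 (opposite t) y v lead≉0 q r
      = opposite t ∷ τ , q ∷ r′ , (begin
      change s t′ ℕ.+ variations t′ σ                        ≤⟨ ℕₚ.+-monoʳ-≤ (change s t′) le ⟩
      change s t′ ℕ.+ (change t′ t′ ℕ.+ variations t′ τ)     ≡⟨ ≡.cong (λ a → change s t′ ℕ.+ (a ℕ.+ variations t′ τ)) (change-refl t′) ⟩
      variations s (t′ ∷ τ)                                  ≤⟨ variations-start s t (t′ ∷ τ) ⟩
      variations s (t ∷ t′ ∷ τ)                              ∎)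

  -- Both sign vectors are arbitrary, so this compares the strong number after the shift with the
  -- weak number before it. `horner-strict` keeps the head sign and returns signs of the shifted
  -- tail, to which the induction applies.
  shift-strict : ∀ {n} {h} → ¬ (h ≤ 0#) → ∀ s (v : Vec Carrier (suc n)) → ¬ (leading v ≈ 0#) →
                 ∀ {σ σ′} → Signs σ v → Signs σ′ (shift h v) → variations s σ′ ℕ.≤ variations s σ
  shift-strict h≰0 s (x ∷ []) lead≉0 (p ∷ []) r′
    with horner-strict h≰0 s x [] lead≉0 p r′
  ... | [] , [] , le = le
  shift-strict {h = h} h≰0 s (x ∷ v@(_ ∷ _)) lead≉0 {t ∷ _} (p ∷ r) r′
    with τ , r″ , le ← horner-strict h≰0 s x (shift h v)
                         (lead≉0 ∘ trans (reflexive (≡.sym (leading-shift h v)))) p r′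
    = ℕₚ.≤-trans le (ℕₚ.+-monoʳ-≤ (change s t) (shift-strict h≰0 t v lead≉0 r r″))

  -- Adding a monomial to a coefficient vector.

  addTerm : ∀ {n} → ℕ → Carrier → Vec Carrier n → Vec Carrier n
  -- A monomial of exponent beyond the vector is dropped, whence the condition `e < n` in
  -- `eval-addTerm`.
  addTerm e       c []      = []
  addTerm zero    c (x ∷ v) = c + x ∷ v
  addTerm (suc e) c (x ∷ v) = x ∷ addTerm e c v

  variations-tail : ∀ {m n} s t (σ : Vec Sign m) (τ : Vec Sign n) →
                    variations t σ ℕ.≤ 2 ℕ.+ variations t τ →
                    variations s (t ∷ σ) ℕ.≤ 2 ℕ.+ variations s (t ∷ τ)
  variations-tail s t σ τ le = begin
    change s t ℕ.+ variations t σ              ≤⟨ ℕₚ.+-monoʳ-≤ (change s t) le ⟩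
    change s t ℕ.+ (2 ℕ.+ variations t τ)      ≡⟨ ℕₚ.+-comm (change s t) _ ⟩
    2 ℕ.+ (variations t τ ℕ.+ change s t)      ≡⟨ ≡.cong (2 ℕ.+_) (ℕₚ.+-comm _ (change s t)) ⟩
    2 ℕ.+ (change s t ℕ.+ variations t τ)      ∎
    where open ℕₚ.≤-Reasoning

  addTerm-weak : ∀ {n} e c s (v : Vec Carrier n) {σ} → Signs σ v →
                 AgreeingWithin (addTerm e c v) s (2 ℕ.+ variations s σ)
  addTerm-weak e c s [] []  = [] , [] , z≤n
  addTerm-weak zero c s (x ∷ v) {u ∷ σ} (p ∷ r)
    with t , p′ ← agrees-some (c + x) = t ∷ σ , p′ ∷ r , variations-head s t u σ
  addTerm-weak (suc e) c s (x ∷ v) {t ∷ σ} (p ∷ r)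
    with τ , r′ , le ← addTerm-weak e c t v r
    = t ∷ τ , p ∷ r′ , variations-tail s t τ σ le

  addTerm-strong : ∀ {n} e c s (v : Vec Carrier n) {σ} → Signs σ (addTerm e c v) →
                   ∃ λ τ → Signs τ v × variations s σ ℕ.≤ 2 ℕ.+ variations s τ
  addTerm-strong e c s [] []  = [] , [] , z≤n
  addTerm-strong zero c s (x ∷ v) {u ∷ σ} (p ∷ r)
    with t , p′ ← agrees-some x = t ∷ σ , p′ ∷ r , variations-head s u t σ
  addTerm-strong (suc e) c s (x ∷ v) {t ∷ σ} (p ∷ r)
    with τ , r′ , le ← addTerm-strong e c t v r
    = t ∷ τ , p ∷ r′ , variations-tail s t σ τ le

  eval-addTerm : ∀ {n} e c (v : Vec Carrier n) y → e ℕ.< n →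
                 eval (addTerm e c v) y ≈ c * pow commRing y e + eval v y
  eval-addTerm zero    c (x ∷ v) y _ = trans (+-assoc c x _) (+-congʳ (sym (*-identityʳ c)))
  eval-addTerm (suc e) c (x ∷ v) y (s≤s e<n) =
    trans (+-congˡ (*-congˡ (eval-addTerm e c v y e<n)))
      (solve 5 (λ x y c p w → x :+ y :* (c :* p :+ w) := c :* (y :* p) :+ (x :+ y :* w))
        refl x y c (pow commRing y e) (eval v y))

  when : ∀ {p} {P : Set p} → Dec P → Carrier → Carrier
  when (yes _) x = x
  when (no  _) x = 0#

  when-true : ∀ {p} {P : Set p} (P? : Dec P) {x} → P → when P? x ≈ x
  when-true (yes _) _ = refl
  when-true (no ¬p) p = contradiction p ¬p

  when-false : ∀ {p} {P : Set p} (P? : Dec P) {x} → ¬ P → when P? x ≈ 0#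
  when-false (yes p) ¬p = contradiction p ¬p
  when-false (no _)  _  = refl

  leading-addTerm : ∀ {n} e c (v : Vec Carrier (suc n)) →
                    leading (addTerm e c v) ≈ when (e ℕ.≟ n) c + leading v
  leading-addTerm         zero    c (x ∷ [])    = refl
  leading-addTerm         (suc e) c (x ∷ [])    = sym (+-identityˡ x)
  leading-addTerm         zero    c (x ∷ y ∷ v) = sym (+-identityˡ _)
  leading-addTerm {suc n} (suc e) c (x ∷ y ∷ v) = trans (leading-addTerm e c (y ∷ v)) (+-congʳ (step (e ℕ.≟ n)))
    where
    step : (d : Dec (e ≡ n)) → when d c ≈ when (suc e ℕ.≟ suc n) c
    step (yes e≡n) = sym (when-true (suc e ℕ.≟ suc n) (≡.cong suc e≡n))
    step (no e≢n)  = sym (when-false (suc e ℕ.≟ suc n) (e≢n ∘ ℕₚ.suc-injective))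

  -- Sums of shifted powers and their Taylor vectors.

  record Term : Set c where
    constructor term
    field
      coef node : Carrier
      expo      : ℕ
  open Term

  ∑ : (Term → Carrier) → List Term → Carrier
  ∑ w []      = 0#
  ∑ w (t ∷ L) = w t + ∑ w L

  ∑-cong : ∀ {w w′ L} → Allₗ (λ t → w t ≈ w′ t) L → ∑ w L ≈ ∑ w′ L
  ∑-cong []       = refl
  ∑-cong (p ∷ ps) = +-cong p (∑-cong ps)

  value : Carrier → Term → Carrier
  value x t = coef t * pow commRing (x - node t) (expo t)

  -- The Taylor coefficients at z of the sum of the terms of L, the next
  -- term being added on arrival at its node.
  taylor : ∀ n → Carrier → List Term → Vec Carrier n
  taylor n z []      = replicate n 0#
  taylor n z (t ∷ L) = shift (z - node t) (addTerm (expo t) (coef t) (taylor n (node t) L))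

  eval-replicate : ∀ n y → eval (replicate n 0#) y ≈ 0#
  eval-replicate zero    y = refl
  eval-replicate (suc n) y = trans (+-identityˡ _) (trans (*-congˡ (eval-replicate n y)) (zeroʳ y))

  pow-cong : ∀ {x y} e → x ≈ y → pow commRing x e ≈ pow commRing y e
  pow-cong zero    x≈y = refl
  pow-cong (suc e) x≈y = *-cong x≈y (pow-cong e x≈y)

  [x-z]+[z-a]≈x-a : ∀ x z a → (x - z) + (z - a) ≈ x - a
  [x-z]+[z-a]≈x-a x z a = trans (sym (+-assoc (x - z) z (- a))) (+-congʳ ([y-x]+x≈y z x))

  eval-taylor : ∀ {n} z x {L} → Allₗ (λ t → expo t ℕ.< n) L →
                eval (taylor n z L) (x - z) ≈ ∑ (value x) L
  eval-taylor {n} z x []                = eval-replicate n (x - z)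
  eval-taylor {n} z x {t ∷ L} (e<n ∷ es) = begin
    eval (shift (z - a) v) (x - z)                ≈⟨ eval-shift (z - a) v (x - z) ⟩
    eval v ((x - z) + (z - a))                    ≈⟨ eval-cong v ([x-z]+[z-a]≈x-a x z a) ⟩
    eval v (x - a)                                ≈⟨ eval-addTerm (expo t) (coef t) (taylor n a L) (x - a) e<n ⟩
    value x t + eval (taylor n a L) (x - a)       ≈⟨ +-congˡ (eval-taylor a x es) ⟩
    value x t + ∑ (value x) L                     ∎
    where
    open SetoidReasoning setoid
    a = node t
    v = addTerm (expo t) (coef t) (taylor n a L)

  leading-replicate : ∀ n → leading (replicate (suc n) 0#) ≡ 0#
  leading-replicate zero    = ≡.refl
  leading-replicate (suc n) = leading-replicate n

  -- Shifts preserve the last coordinate, so it simply accumulates the coefficients of exponent `n`.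
  leading-taylor : ∀ n z L → leading (taylor (suc n) z L) ≈ ∑ (λ t → when (expo t ℕ.≟ n) (coef t)) L
  leading-taylor n z []      = reflexive (leading-replicate n)
  leading-taylor n z (t ∷ L) = begin
    leading (shift (z - node t) v)                                    ≡⟨ leading-shift (z - node t) v ⟩
    leading v                                                         ≈⟨ leading-addTerm (expo t) (coef t) (taylor (suc n) (node t) L) ⟩
    when (expo t ℕ.≟ n) (coef t) + leading (taylor (suc n) (node t) L) ≈⟨ +-congˡ (leading-taylor n (node t) L) ⟩
    ∑ (λ t → when (expo t ℕ.≟ n) (coef t)) (t ∷ L)                    ∎
    where
    open SetoidReasoning setoid
    v = addTerm (expo t) (coef t) (taylor (suc n) (node t) L)

  -- Bounding the variations of Taylor vectors.

  data Descending : Carrier → List Term → Set (c ⊔ ℓ) where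
    []  : ∀ {z} → Descending z []
    -- The head has the rightmost node, so every shift in `taylor` is by a nonnegative amount.
    _∷_ : ∀ {z t L} → node t ≤ z → Descending (node t) L → Descending z (t ∷ L)

  signs-zero : ∀ {n} (σ : Vec Sign n) {v} → All (_≈ 0#) v → Signs σ v
  signs-zero []      []       = []
  signs-zero (s ∷ σ) (z ∷ zs) = agrees-zero s z ∷ signs-zero σ zs

  replicate-zero : ∀ n → All (_≈ 0#) (replicate n 0#)
  replicate-zero zero    = []
  replicate-zero (suc n) = refl ∷ replicate-zero n

  taylor-weak : ∀ {n z L} → Descending z L → ∀ s → AgreeingWithin (taylor n z L) s (length L ℕ.* 2)

  addTerm-taylor-weak : ∀ {n t L} → Descending (node t) L → ∀ s →
    AgreeingWithin (addTerm (expo t) (coef t) (taylor n (node t) L)) s (length (t ∷ L) ℕ.* 2)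
  addTerm-taylor-weak {n} {t} {L} d s
    with σ , r , le ← taylor-weak {n} d s
    with σ′ , r′ , le′ ← addTerm-weak (expo t) (coef t) s (taylor n (node t) L) r
    = σ′ , r′ , ℕₚ.≤-trans le′ (ℕₚ.+-monoʳ-≤ 2 le)

  -- Zero agrees with every sign, so repeating the start sign gives no variations.
  taylor-weak {n} [] s = replicate n s , signs-zero _ (replicate-zero n) , ℕₚ.≤-reflexive (variations-replicate s n)
  taylor-weak {n} (a≤z ∷ d) s
    with σ , r , le ← addTerm-taylor-weak {n} d s
    with σ′ , r′ , le′ ← shift-weak (x≤y⇒0≤y-x a≤z) s _ r
    = σ′ , r′ , ℕₚ.≤-trans le′ le

  -- Quantifying over all agreeing `σ` makes this a bound on the strong number.
  Bounded : ℕ → Carrier → List Term → Set (c ⊔ ℓ)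
  Bounded n z L = ∀ s {σ} → Signs σ (taylor n z L) → variations s σ ℕ.≤ length L ℕ.* 2

  bounded-∷ : ∀ {n z t L} → node t ≤ z → Bounded n (node t) L → Bounded n z (t ∷ L)
  bounded-∷ {n} {z} {t} {L} a≤z bounded s r
    with σ₁ , r₁ , le₁ ← shift-strong (x≤y⇒0≤y-x a≤z) s (addTerm (expo t) (coef t) (taylor n (node t) L)) r
    with σ₂ , r₂ , le₂ ← addTerm-strong (expo t) (coef t) s (taylor n (node t) L) r₁
    = ℕₚ.≤-trans le₁ (ℕₚ.≤-trans le₂ (ℕₚ.+-monoʳ-≤ 2 (bounded s r₂)))

  -- This is where a weak bound turns into a strong one: the shift from `node t` to `z` has positive
  -- length and the last coordinate is nonzero, so `shift-strict` applies.
  bounded-strict : ∀ {n z t L} → ¬ (z ≤ node t) → Descending (node t) L →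
                   ¬ (∑ (λ t → when (expo t ℕ.≟ n) (coef t)) (t ∷ L) ≈ 0#) → Bounded (suc n) z (t ∷ L)
  bounded-strict {n} {z} {t} {L} z≰a d lead≉0 s r
    with σ , r′ , le ← addTerm-taylor-weak {suc n} {t} d s
    = ℕₚ.≤-trans (shift-strict z-a≰0 s v v≉0 r′ r) le
    where
    v = addTerm (expo t) (coef t) (taylor (suc n) (node t) L)
    z-a≰0 : ¬ (z - node t ≤ 0#)
    z-a≰0 p = z≰a (≤-respˡ-≈ ([y-x]+x≈y _ z) (≤-respʳ-≈ (+-identityˡ _) (+-mono-≤ (node t) p)))
    v≉0 : ¬ (leading v ≈ 0#)
    v≉0 p = lead≉0 (trans (sym (leading-taylor n z (t ∷ L))) (trans (reflexive (leading-shift (z - node t) v)) p))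

  -- Sums over lists, and sorting by node.

  ∑-++ : ∀ w L M → ∑ w (L ++ M) ≈ ∑ w L + ∑ w M
  ∑-++ w []      M = sym (+-identityˡ _)
  ∑-++ w (t ∷ L) M = trans (+-congˡ (∑-++ w L M)) (sym (+-assoc _ _ _))

  ∑-+ : ∀ w w′ L → ∑ (λ t → w t + w′ t) L ≈ ∑ w L + ∑ w′ L
  ∑-+ w w′ []      = sym (+-identityˡ 0#)
  ∑-+ w w′ (t ∷ L) = trans (+-congˡ (∑-+ w w′ L))
    (solve 4 (λ a b x y → (a :+ b) :+ (x :+ y) := (a :+ x) :+ (b :+ y)) refl (w t) (w′ t) _ _)

  ∑-*ʳ : ∀ w x L → ∑ (λ t → w t * x) L ≈ ∑ w L * x
  ∑-*ʳ w x []      = sym (zeroˡ x)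
  ∑-*ʳ w x (t ∷ L) = trans (+-congˡ (∑-*ʳ w x L)) (sym (distribʳ x (w t) (∑ w L)))

  ∑-zero : ∀ {w L} → Allₗ (λ t → w t ≈ 0#) L → ∑ w L ≈ 0#
  ∑-zero []       = refl
  ∑-zero (z ∷ zs) = trans (+-cong z (∑-zero zs)) (+-identityˡ 0#)

  ∑-↭ : ∀ w {L M} → L ↭ M → ∑ w L ≈ ∑ w M
  ∑-↭ w ↭.refl         = refl
  ∑-↭ w (↭.prep t p)   = +-congˡ (∑-↭ w p)
  ∑-↭ w (↭.swap t u p) = trans (+-congˡ (+-congˡ (∑-↭ w p)))
    (solve 3 (λ x y z → x :+ (y :+ z) := y :+ (x :+ z)) refl (w t) (w u) _)
  ∑-↭ w (↭.trans p q)  = trans (∑-↭ w p) (∑-↭ w q)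

  ∑-filter : ∀ {p} {P : Term → Set p} (P? : ∀ t → Dec (P t)) w L →
             ∑ w L ≈ ∑ (λ t → when (P? t) (w t)) L + ∑ w (filter (¬? ∘ P?) L)
  ∑-filter P? w []      = sym (+-identityˡ 0#)
  ∑-filter P? w (t ∷ L) with P? t
  ... | yes _ = trans (+-congˡ (∑-filter P? w L)) (sym (+-assoc _ _ _))
  ... | no _  = trans (+-congˡ (∑-filter P? w L))
    (solve 3 (λ x y z → x :+ (y :+ z) := (con 0 :+ y) :+ (x :+ z)) refl (w t) _ _)

  descending⇒≤ : ∀ {z L} → Descending z L → Allₗ (λ t → node t ≤ z) L
  descending⇒≤ []        = []
  descending⇒≤ (a≤z ∷ d) = a≤z ∷ Listₐ.map (λ b≤a → ≤-trans b≤a a≤z) (descending⇒≤ d)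

  byDecreasingNode : DecTotalOrder c ℓ ℓ
  byDecreasingNode = On.decTotalOrder (Flip.decTotalOrder decTotalOrder) node

  open Sort byDecreasingNode using (sort; sort-↭; sort-↗)

  sorted⇒descending : ∀ {z L} → Allₗ (λ t → node t ≤ z) L → Linked (λ t u → node u ≤ node t) L → Descending z L
  sorted⇒descending []        _      = []
  sorted⇒descending (a≤z ∷ _) linked = descending a≤z linked
    where
    descending : ∀ {z t L} → node t ≤ z → Linked (λ t u → node u ≤ node t) (t ∷ L) → Descending z (t ∷ L)
    descending a≤z [-]        = a≤z ∷ []
    descending a≤z (b≤a ∷ ls) = a≤z ∷ descending b≤a ls

  upperBound : ∀ a L → ∃ λ z → ¬ (z ≤ a) × Allₗ (λ t → node t ≤ z) L
  upperBound a []      = a + 1# , x+1≰x a , []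
  upperBound a (t ∷ L) with upperBound a L
  ... | z , z≰a , L≤z with total (node t) z
  ...   | inj₁ b≤z = z , z≰a , b≤z ∷ L≤z
  ...   | inj₂ z≤b = node t , (z≰a ∘ ≤-trans z≤b) , ≤-refl ∷ Listₐ.map (λ p → ≤-trans p z≤b) L≤z

  -- Coefficients of the top exponent on one side of a cut.

  module _ (D : Carrier → Set ℓ) (D? : ∀ x → Dec (D x)) (D-down : ∀ {x y} → x ≤ y → D y → D x) (n : ℕ) where

    -- `D` is the left part of a cut of the line. It will be taken to be both the closed and the
    -- open half-line ending at `a`, whose difference isolates the node `a`.
    below : Term → Carrier
    below t = when (D? (node t) ×-dec expo t ℕ.≟ n) (coef t)

    -- Terms outside `D` add nothing to the sum and are passed by `bounded-∷`. At the first node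
    -- inside `D`, all remaining terms lie in `D`, so the sum is the last coordinate of the Taylor
    -- vector; as `z` is outside `D`, the gap before it has positive length.
    bounded : ∀ {z L} → Descending z L → ¬ D z → ¬ (∑ below L ≈ 0#) → Bounded (suc n) z L
    bounded []                         ¬Dz ≉0 = contradiction refl ≉0
    bounded {z} {t ∷ L} (a≤z ∷ d) ¬Dz ≉0 = go (D? (node t))
      where
      go : Dec (D (node t)) → Bounded (suc n) z (t ∷ L)
      go (yes Da) = bounded-strict {t = t} {L} (λ z≤a → ¬Dz (D-down z≤a Da)) d
        (≉0 ∘ trans (∑-cong (Listₐ.map all-below (≤-refl ∷ descending⇒≤ d))))
        where
        all-below : ∀ {u} → node u ≤ node t → below u ≈ when (expo u ℕ.≟ n) (coef u)
        all-below {u} b≤a with expo u ℕ.≟ n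
        ... | yes e≡n = when-true (D? (node u) ×-dec yes e≡n) (D-down b≤a Da , e≡n)
        ... | no e≢n  = when-false (D? (node u) ×-dec no e≢n) (e≢n ∘ proj₂)
      go (no ¬Da) = bounded-∷ {t = t} {L} a≤z (bounded d ¬Da (≉0 ∘ λ eq →
        trans (+-cong (when-false (D? (node t) ×-dec expo t ℕ.≟ n) (¬Da ∘ proj₁)) eq) (+-identityˡ 0#)))

    below-vanishes : ∀ a → (∀ {z} → D z → z ≤ a) → ∀ L → Allₗ (λ t → expo t ℕ.≤ n) L →
                     length L ℕ.* 2 ℕ.≤ n → (∀ x → ∑ (value x) L ≈ 0#) → ∑ below L ≈ 0#
    below-vanishes a D≤a L L≤n short vanishes
      -- A point right of all nodes, where the Taylor vector is zero, and strictly right of `a`,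
      -- hence outside `D`.
      with z , z≰a , L≤z ← upperBound a L
      with ∑ below (sort L) ≟ 0#
    ... | yes ≈0 = trans (∑-↭ below (↭-sym (sort-↭ L))) ≈0
    ... | no ≉0  = contradiction (begin
        -- The zero vector agrees with alternating signs, which vary `suc n` times.
        suc n                                           ≡⟨ variations-alternating ⊕ (suc n) ⟨
        variations ⊕ (alternating ⊕ (suc n))            ≤⟨ bounded descending (z≰a ∘ D≤a) ≉0 ⊕ (signs-zero (alternating ⊕ (suc n)) zeros) ⟩
        length (sort L) ℕ.* 2                           ≡⟨ ≡.cong (ℕ._* 2) (↭-length (sort-↭ L)) ⟩
        length L ℕ.* 2                                  ≤⟨ short ⟩
        n                                               ∎) ℕₚ.1+n≰n
      where
      open ℕₚ.≤-Reasoning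
      descending : Descending z (sort L)
      descending = sorted⇒descending (All-resp-↭ (↭-sym (sort-↭ L)) L≤z) (sort-↗ L)
      zeros : All (_≈ 0#) (taylor (suc n) z (sort L))
      zeros = vanishing⇒zero (taylor (suc n) z (sort L)) λ y _ →
        trans (eval-cong (taylor (suc n) z (sort L)) (sym (xyx⁻¹≈y z y)))
        (trans (eval-taylor z (z + y) (All-resp-↭ (↭-sym (sort-↭ L)) (Listₐ.map s≤s L≤n)))
        (trans (∑-↭ (value (z + y)) (sort-↭ L)) (vanishes (z + y))))

  -- Coefficients at a single node, and descent on the top exponent.

  atNode? : ∀ a n t → Dec (node t ≈ a × expo t ≡ n)
  atNode? a n t = (node t ≟ a) ×-dec (expo t ℕ.≟ n)

  group : Carrier → ℕ → Term → Carrier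
  group a n t = when (atNode? a n t) (coef t)

  -- The terms with node at most `a` are those at `a` together with those strictly left of `a`;
  -- `below-vanishes` applies to both half-lines.
  group-vanishes : ∀ n L → Allₗ (λ t → expo t ℕ.≤ n) L → length L ℕ.* 2 ℕ.≤ n →
                   (∀ x → ∑ (value x) L ≈ 0#) → ∀ a → ∑ (group a n) L ≈ 0#
  group-vanishes n L L≤n short vanishes a = begin
    ∑ (group a n) L                    ≈⟨ +-identityʳ _ ⟨
    ∑ (group a n) L + 0#               ≈⟨ +-congˡ (below-vanishes (λ x → ¬ (a ≤ x)) <a? (λ x≤y y<a → y<a ∘ λ a≤x → ≤-trans a≤x x≤y) n a ≰⇒≥ L L≤n short vanishes) ⟨
    ∑ (group a n) L + ∑ strict L       ≈⟨ ∑-+ (group a n) strict L ⟨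
    ∑ (λ t → group a n t + strict t) L ≈⟨ ∑-cong (Listₐ.universal split L) ⟨
    ∑ weak L                           ≈⟨ below-vanishes (_≤ a) (_≤? a) ≤-trans n a (λ z≤a → z≤a) L L≤n short vanishes ⟩
    0#                                 ∎
    where
    open SetoidReasoning setoid
    <a? : ∀ x → Dec (¬ (a ≤ x))
    <a? x = ¬? (a ≤? x)
    ≰⇒≥ : ∀ {x} → ¬ (a ≤ x) → x ≤ a
    ≰⇒≥ {x} a≰x with total x a
    ... | inj₁ x≤a = x≤a
    ... | inj₂ a≤x = contradiction a≤x a≰x
    weak strict : Term → Carrier
    weak t   = when ((node t ≤? a) ×-dec expo t ℕ.≟ n) (coef t)
    strict t = when (<a? (node t) ×-dec expo t ℕ.≟ n) (coef t)
    split : ∀ t → weak t ≈ group a n t + strict t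
    split t with node t ≤? a | node t ≟ a | a ≤? node t | expo t ℕ.≟ n
    ... | yes _   | yes _   | yes _   | yes _ = sym (+-identityʳ _)
    ... | yes _   | no _    | no _    | yes _ = sym (+-identityˡ _)
    ... | no _    | no _    | yes _   | yes _ = sym (+-identityˡ _)
    ... | yes b≤a | no b≉a  | yes a≤b | yes _ = contradiction (antisym b≤a a≤b) b≉a
    ... | _       | yes b≈a | no a≰b  | yes _ = contradiction (≤-reflexive (sym b≈a)) a≰b
    ... | no b≰a  | yes b≈a | _       | yes _ = contradiction (≤-reflexive b≈a) b≰a
    ... | no b≰a  | _       | no a≰b  | yes _ = contradiction (≰⇒≥ a≰b) b≰a
    ... | yes _   | yes _   | yes _   | no _ = sym (+-identityʳ _)
    ... | yes _   | yes _   | no _    | no _ = sym (+-identityʳ _)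
    ... | yes _   | no _    | yes _   | no _ = sym (+-identityʳ _)
    ... | yes _   | no _    | no _    | no _ = sym (+-identityʳ _)
    ... | no _    | yes _   | yes _   | no _ = sym (+-identityʳ _)
    ... | no _    | yes _   | no _    | no _ = sym (+-identityʳ _)
    ... | no _    | no _    | yes _   | no _ = sym (+-identityʳ _)
    ... | no _    | no _    | no _    | no _ = sym (+-identityʳ _)

  -- Terms of exponent above d are removed one node at a time, top exponent
  -- first: their coefficients at that node sum to zero.
  group-vanishes-below-top : ∀ d m N L → length L ℕ.≤ N → Allₗ (λ t → expo t ℕ.≤ m ℕ.+ d) L →
    length L ℕ.* 2 ℕ.≤ d → (∀ x → ∑ (value x) L ≈ 0#) → ∀ a → ∑ (group a d) L ≈ 0#
  group-vanishes-below-top d zero    N L len≤N L≤ short vanishes a = group-vanishes d L L≤ short vanishes a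
  group-vanishes-below-top d (suc m) N L len≤N L≤ short vanishes a with any? (λ t → expo t ℕ.≟ suc m ℕ.+ d) L
  ... | no none = group-vanishes-below-top d m N L len≤N
        (Listₐ.zipWith (λ (e≤ , e≢) → ℕₚ.≤-pred (ℕₚ.≤∧≢⇒< e≤ e≢)) (L≤ , ¬Any⇒All¬ L none)) short vanishes a
  ... | yes some with find some
  ...   | t , t∈L , e≡ = go N len≤N
    where
    open SetoidReasoning setoid
    top = suc m ℕ.+ d
    P? = atNode? (node t) top
    L′ = filter (¬? ∘ P?) L
    L′<L : length L′ ℕ.< length L
    L′<L = filter-notAll (¬? ∘ P?) L (lose t∈L (λ ¬p → ¬p (refl , e≡)))
    value-at : ∀ x u → when (P? u) (value x u) ≈ group (node t) top u * pow commRing (x - node t) top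
    value-at x u with P? u
    ... | yes (b≈a , ≡.refl) = *-congˡ (pow-cong (expo u) (+-congˡ (-‿cong b≈a)))
    ... | no _               = sym (zeroˡ _)
    -- The removed terms share node and exponent, so they add up to a single power times their group
    -- coefficient, which is zero.
    vanishes′ : ∀ x → ∑ (value x) L′ ≈ 0#
    vanishes′ x = begin
      ∑ (value x) L′                                                              ≈⟨ +-identityˡ _ ⟨
      0# + ∑ (value x) L′                                                         ≈⟨ +-congʳ (zeroˡ _) ⟨
      0# * pow commRing (x - node t) top + ∑ (value x) L′
        ≈⟨ +-congʳ (*-congʳ (group-vanishes top L L≤ (ℕₚ.≤-trans short (ℕₚ.m≤n+m d (suc m))) vanishes (node t))) ⟨
      ∑ (group (node t) top) L * pow commRing (x - node t) top + ∑ (value x) L′   ≈⟨ +-congʳ (∑-*ʳ (group (node t) top) _ L) ⟨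
      ∑ (λ u → group (node t) top u * pow commRing (x - node t) top) L + ∑ (value x) L′
        ≈⟨ +-congʳ (∑-cong (Listₐ.universal (value-at x) L)) ⟨
      ∑ (λ u → when (P? u) (value x u)) L + ∑ (value x) L′                        ≈⟨ ∑-filter P? (value x) L ⟨
      ∑ (value x) L                                                               ≈⟨ vanishes x ⟩
      0#                                                                          ∎
    -- Removed terms have exponent `top`, which differs from `d`, so the group sum at exponent `d`
    -- is unaffected.
    group-at : ∀ u → when (P? u) (group a d u) ≈ 0#
    group-at u with P? u
    ... | yes (_ , e≡top) = when-false (atNode? a d u) λ (_ , e≡d) → ℕₚ.m≢1+n+m d (≡.trans (≡.sym e≡d) e≡top)
    ... | no _            = refl
    -- `N` bounds the length and decreases with each removal, while `m` stays fixed until no term of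
    -- exponent `top` is left.
    go : ∀ N → length L ℕ.≤ N → ∑ (group a d) L ≈ 0#
    go zero    len≤0 = contradiction (ℕₚ.<-≤-trans L′<L len≤0) λ ()
    go (suc N) len≤N = begin
      ∑ (group a d) L                                                             ≈⟨ ∑-filter P? (group a d) L ⟩
      ∑ (λ u → when (P? u) (group a d u)) L + ∑ (group a d) L′                    ≈⟨ +-cong (∑-zero (Listₐ.universal group-at L))
        (group-vanishes-below-top d (suc m) N L′ (ℕₚ.≤-pred (ℕₚ.<-≤-trans L′<L len≤N)) (filter⁺ (¬? ∘ P?) L≤)
          (ℕₚ.≤-trans (ℕₚ.*-monoˡ-≤ 2 (ℕₚ.<⇒≤ L′<L)) short) vanishes′ a) ⟩
      0# + 0#                                                                     ≈⟨ +-identityˡ 0# ⟩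
      0#                                                                          ∎

  -- Sums over finite index sets.

  sumFin-cong : ∀ n {f g : Fin n → Carrier} → (∀ i → f i ≈ g i) → sumFin commRing n f ≈ sumFin commRing n g
  sumFin-cong zero    f≈g = refl
  sumFin-cong (suc n) f≈g = +-cong (f≈g zero) (sumFin-cong n (f≈g ∘ suc))

  sumFin-zero : ∀ n {f : Fin n → Carrier} → (∀ i → f i ≈ 0#) → sumFin commRing n f ≈ 0#
  sumFin-zero zero    f≈0 = refl
  sumFin-zero (suc n) f≈0 = trans (+-cong (f≈0 zero) (sumFin-zero n (f≈0 ∘ suc))) (+-identityˡ 0#)

  sumFin-single : ∀ n {f : Fin n → Carrier} i → (∀ j → ¬ (j ≡ i) → f j ≈ 0#) → sumFin commRing n f ≈ f i
  sumFin-single (suc n) zero    f≈0 =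
    trans (+-congˡ (sumFin-zero n λ j → f≈0 (suc j) λ ())) (+-identityʳ _)
  sumFin-single (suc n) (suc i) f≈0 =
    trans (+-cong (f≈0 zero λ ()) (sumFin-single n i λ j j≢i → f≈0 (suc j) (j≢i ∘ Finₚ.suc-injective))) (+-identityˡ _)

  sumFin-neg : ∀ n (f : Fin n → Carrier) → sumFin commRing n (λ i → - f i) ≈ - sumFin commRing n f
  sumFin-neg zero    f = sym -0#≈0#
  sumFin-neg (suc n) f = trans (+-congˡ (sumFin-neg n (f ∘ suc))) (-‿+-comm _ _)

  ∑-tabulate : ∀ w n (f : Fin n → Term) → ∑ w (tabulate f) ≡ sumFin commRing n (w ∘ f)
  ∑-tabulate w zero    f = ≡.refl
  ∑-tabulate w (suc n) f = ≡.cong (w (f zero) +_) (∑-tabulate w n (f ∘ suc))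

  -- The lower bound over an ordered domain.

  expo-bound : ∀ L → ∃ λ m → Allₗ (λ t → expo t ℕ.≤ m) L
  expo-bound []      = 0 , []
  expo-bound (t ∷ L) with m , L≤m ← expo-bound L
    = expo t ℕ.⊔ m , ℕₚ.m≤m⊔n _ _ ∷ Listₐ.map (λ e≤m → ℕₚ.≤-trans e≤m (ℕₚ.m≤n⊔m (expo t) m)) L≤m

  lower-bound : (d k : ℕ) (xs α : Fin k → Carrier) →
    (∀ i j → xs i ≈ xs j → i ≡ j) → (∀ i → ¬ (α i ≈ 0#)) → 4 ℕ.* k ℕ.≤ d ℕ.+ 2 →
    (l : ℕ) (β ys : Fin l → Carrier) (e : Fin l → ℕ) →
    (∀ x → sumFin commRing k (λ i → α i * pow commRing (x + xs i) d)
         ≈ sumFin commRing l (λ i → β i * pow commRing (x + ys i) (e i))) →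
    k ℕ.≤ l
  lower-bound d k xs α xs-injective α≉0 4k≤d+2 l β ys e H with k ℕ.≤? l
  ... | yes k≤l = k≤l
  -- If every left term has a right term of exponent `d` with the same node, choosing one for each
  -- is injective because the nodes are distinct. Otherwise some left term is isolated.
  ... | no k≰l with Finₚ.all? (λ i → Finₚ.any? λ j → (e j ℕ.≟ d) ×-dec (ys j ≟ xs i))
  ...   | yes match = Finₚ.injective⇒≤ λ {i} {j} eq → xs-injective i j
          (trans (sym (proj₂ (proj₂ (match i)))) (trans (reflexive (≡.cong ys eq)) (proj₂ (proj₂ (match j)))))
  ...   | no ¬match with i , isolated ← Finₚ.¬∀⟶∃¬ k _ (λ i → Finₚ.any? λ j → (e j ℕ.≟ d) ×-dec (ys j ≟ xs i)) ¬match
    = contradiction αᵢ≈0 (α≉0 i)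
    where
    left : Fin k → Term
    left j = term (α j) (- xs j) d
    right : Fin l → Term
    right j = term (- β j) (- ys j) (e j)
    L = tabulate left ++ tabulate right

    ∑-L : ∀ w → ∑ w L ≈ sumFin commRing k (w ∘ left) + sumFin commRing l (w ∘ right)
    ∑-L w = trans (∑-++ w (tabulate left) (tabulate right))
      (+-cong (reflexive (∑-tabulate w k left)) (reflexive (∑-tabulate w l right)))

    -‿injective : ∀ {x y} → - x ≈ - y → x ≈ y
    -‿injective p = trans (sym (-‿involutive _)) (trans (-‿cong p) (-‿involutive _))

    [k+k]*2≡4*k : ∀ k → (k ℕ.+ k) ℕ.* 2 ≡ 4 ℕ.* k
    [k+k]*2≡4*k = solve-∀

    -- From `l < k` one gets `2 * (k + l) + 2 ≤ 4 * k ≤ d + 2`; the strictness of `l < k` absorbs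
    -- exactly the 2 in the hypothesis.
    short : length L ℕ.* 2 ℕ.≤ d
    short = ℕₚ.+-cancelʳ-≤ 2 _ _ (begin
      length L ℕ.* 2 ℕ.+ 2         ≡⟨ ≡.cong (λ m → m ℕ.* 2 ℕ.+ 2) (≡.trans (length-++ (tabulate left))
                                       (≡.cong₂ ℕ._+_ (length-tabulate left) (length-tabulate right))) ⟩
      (k ℕ.+ l) ℕ.* 2 ℕ.+ 2        ≡⟨ ℕₚ.+-comm _ 2 ⟩
      suc (k ℕ.+ l) ℕ.* 2          ≡⟨ ≡.cong (ℕ._* 2) (ℕₚ.+-suc k l) ⟨
      (k ℕ.+ suc l) ℕ.* 2          ≤⟨ ℕₚ.*-monoˡ-≤ 2 (ℕₚ.+-monoʳ-≤ k (ℕₚ.≰⇒> k≰l)) ⟩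
      (k ℕ.+ k) ℕ.* 2              ≡⟨ [k+k]*2≡4*k k ⟩
      4 ℕ.* k                      ≤⟨ 4k≤d+2 ⟩
      d ℕ.+ 2                      ∎)
      where open ℕₚ.≤-Reasoning

    vanishes : ∀ x → ∑ (value x) L ≈ 0#
    vanishes x = begin
      ∑ (value x) L                                        ≈⟨ ∑-L (value x) ⟩
      sumFin commRing k (value x ∘ left) + sumFin commRing l (value x ∘ right)
        ≈⟨ +-cong (sumFin-cong k λ j → *-congˡ (pow-cong d (+-congˡ (-‿involutive (xs j)))))
                  (trans (sumFin-cong l λ j → trans (sym (-‿distribˡ-* (β j) _))
                           (-‿cong (*-congˡ (pow-cong (e j) (+-congˡ (-‿involutive (ys j)))))))
                         (sumFin-neg l _)) ⟩
      sumFin commRing k (λ i → α i * pow commRing (x + xs i) d)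
        - sumFin commRing l (λ i → β i * pow commRing (x + ys i) (e i))   ≈⟨ +-congʳ (H x) ⟩
      sumFin commRing l (λ i → β i * pow commRing (x + ys i) (e i))
        - sumFin commRing l (λ i → β i * pow commRing (x + ys i) (e i))   ≈⟨ -‿inverseʳ _ ⟩
      0#                                                   ∎
      where open SetoidReasoning setoid

    group≈0 : ∑ (group (- xs i) d) L ≈ 0#
    group≈0 with m , L≤m ← expo-bound L
      = group-vanishes-below-top d m (length L) L ℕₚ.≤-refl
          (Listₐ.map (λ e≤m → ℕₚ.≤-trans e≤m (ℕₚ.m≤m+n m d)) L≤m) short vanishes (- xs i)

    -- Distinctness of the nodes leaves only the `i`-th left term in the group, and `isolated`
    -- excludes every right term.
    αᵢ≈0 : α i ≈ 0#
    αᵢ≈0 = begin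
      α i                                   ≈⟨ when-true (atNode? (- xs i) d (left i)) (refl , ≡.refl) ⟨
      group (- xs i) d (left i)             ≈⟨ sumFin-single k i (λ j j≢i → when-false (atNode? (- xs i) d (left j))
                                                 (j≢i ∘ xs-injective j i ∘ -‿injective ∘ proj₁)) ⟨
      sumFin commRing k (group (- xs i) d ∘ left)  ≈⟨ +-identityʳ _ ⟨
      sumFin commRing k (group (- xs i) d ∘ left) + 0#
        ≈⟨ +-congˡ (sumFin-zero l λ j → when-false (atNode? (- xs i) d (right j))
             λ (p , q) → isolated (j , q , -‿injective p)) ⟨
      sumFin commRing k (group (- xs i) d ∘ left) + sumFin commRing l (group (- xs i) d ∘ right)
                                            ≈⟨ ∑-L (group (- xs i) d) ⟨
      ∑ (group (- xs i) d) L                ≈⟨ group≈0 ⟩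
      0#                                    ∎
      where open SetoidReasoning setoid

-- Completeness decides negated propositions.  Passing to the double
-- negations of ≈ and ≤ therefore makes both decidable.
module DoubleNegation {c ℓ : Level} (ℝ : RealField c ℓ) where
  open RealField ℝ hiding (zero)
  open IsTotalOrder ≤-isTotalOrder using (total; antisym; ≤-respˡ-≈; ≤-respʳ-≈)
    renaming (trans to ≤-trans; reflexive to ≤-reflexive)
  open RingProperties ring using (-‿involutive; -0#≈0#)

  -1≉0 : ¬ (- 1# ≈ 0#)
  -1≉0 p = 0≉1 (trans (sym -0#≈0#) (trans (-‿cong (sym p)) (-‿involutive 1#)))

  -- Whichever side of zero 1 lies on, its negative lies on the other.
  opposite-nonzero : ∃ λ x → ∃ λ y → (x ≤ 0# × ¬ (x ≈ 0#)) × (0# ≤ y × ¬ (y ≈ 0#))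
  opposite-nonzero with total 0# 1#
  ... | inj₁ 0≤1 = - 1# , 1# ,
    (≤-respˡ-≈ (+-identityˡ _) (≤-respʳ-≈ (-‿inverseʳ _) (+-mono-≤ (- 1#) 0≤1)) , -1≉0) , (0≤1 , 0≉1 ∘ sym)
  ... | inj₂ 1≤0 = 1# , - 1# ,
    (1≤0 , 0≉1 ∘ sym) , (≤-respˡ-≈ (-‿inverseʳ _) (≤-respʳ-≈ (+-identityˡ _) (+-mono-≤ (- 1#) 1≤0)) , -1≉0)

  -- The supremum of {x} ∪ {y | A}, for x < 0 < y, is compared with 0.
  weak-excluded-middle : (A : Set (c ⊔ ℓ)) → ¬ A ⊎ ¬ ¬ A
  weak-excluded-middle A
    with x , y , (x≤0 , x≉0) , (0≤y , y≉0) ← opposite-nonzero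
    with s , upper , least ← complete (λ z → Lift c (z ≈ x) ⊎ (A × Lift c (z ≈ y)))
           (x , inj₁ (lift refl))
           (y , λ { z (inj₁ (lift z≈x))     → ≤-respˡ-≈ (sym z≈x) (≤-trans x≤0 0≤y)
                  ; z (inj₂ (_ , lift z≈y)) → ≤-reflexive z≈y })
    with total s 0#
  ... | inj₁ s≤0 = inj₁ λ a → y≉0 (antisym (≤-trans (upper y (inj₂ (a , lift refl))) s≤0) 0≤y)
  ... | inj₂ 0≤s = inj₂ λ ¬a → x≉0 (antisym x≤0 (≤-trans 0≤s (least x
          λ { z (inj₁ (lift z≈x)) → ≤-reflexive z≈x
            ; z (inj₂ (a , _))    → contradiction a ¬a })))

  ¬¬? : (A : Set ℓ) → Dec (¬ ¬ A)
  ¬¬? A with weak-excluded-middle (Lift c A)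
  ... | inj₁ ¬a  = no λ ¬¬a → ¬¬a (¬a ∘ lift)
  ... | inj₂ ¬¬a = yes λ ¬a → ¬¬a (¬a ∘ lower)

  return : ∀ {a} {A : Set a} → A → ¬ ¬ A
  return x k = k x

  lift₂ : ∀ {a b c} {A : Set a} {B : Set b} {C : Set c} → (A → B → C) → ¬ ¬ A → ¬ ¬ B → ¬ ¬ C
  lift₂ f ¬¬x ¬¬y k = ¬¬x λ x → ¬¬y λ y → k (f x y)

  ≈-isEquivalence : IsEquivalence (λ x y → ¬ ¬ (x ≈ y))
  ≈-isEquivalence = record { refl = return refl ; sym = ¬¬-map sym ; trans = lift₂ trans }

  stableRing : CommutativeRing c ℓ
  stableRing = record
    { Carrier = Carrier
    ; _≈_ = λ x y → ¬ ¬ (x ≈ y)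
    ; _+_ = _+_
    ; _*_ = _*_
    ; -_  = -_
    ; 0#  = 0#
    ; 1#  = 1#
    ; isCommutativeRing = record
      { isRing = record
        { +-isAbelianGroup = record
          { isGroup = record
            { isMonoid = record
              { isSemigroup = record
                { isMagma = record { isEquivalence = ≈-isEquivalence ; ∙-cong = lift₂ +-cong }
                ; assoc   = λ x y z → return (+-assoc x y z)
                }
              ; identity = (λ x → return (+-identityˡ x)) , (λ x → return (+-identityʳ x))
              }
            ; inverse = (λ x → return (-‿inverseˡ x)) , (λ x → return (-‿inverseʳ x))
            ; ⁻¹-cong = ¬¬-map -‿cong
            }
          ; comm = λ x y → return (+-comm x y)
          }
        ; *-cong     = lift₂ *-cong
        ; *-assoc    = λ x y z → return (*-assoc x y z)
        ; *-identity = (λ x → return (*-identityˡ x)) , (λ x → return (*-identityʳ x))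
        ; distrib    = (λ x y z → return (distribˡ x y z)) , (λ x y z → return (distribʳ x y z))
        }
      ; *-comm = λ x y → return (*-comm x y)
      }
    }

  cancel-0 : ∀ {x y} → ¬ (x ≈ 0#) → x * y ≈ 0# → y ≈ 0#
  cancel-0 {x} {y} x≉0 xy≈0 with z , xz≈1 ← inverse x x≉0 = begin
    y              ≈⟨ *-identityˡ y ⟨
    1# * y         ≈⟨ *-congʳ (trans (*-comm z x) xz≈1) ⟨
    (z * x) * y    ≈⟨ *-assoc z x y ⟩
    z * (x * y)    ≈⟨ *-congˡ xy≈0 ⟩
    z * 0#         ≈⟨ zeroʳ z ⟩
    0#             ∎
    where open SetoidReasoning setoid

  domain : DiscreteOrderedDomain c ℓ
  domain = record
    { commRing = stableRing
    ; _≤_ = λ x y → ¬ ¬ (x ≤ y)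
    ; isDecTotalOrder = record
      { isTotalOrder = record
        { isPartialOrder = record
          { isPreorder = record
            { isEquivalence = ≈-isEquivalence
            ; reflexive     = ¬¬-map ≤-reflexive
            ; trans         = lift₂ ≤-trans
            }
          ; antisym = lift₂ antisym
          }
        ; total = λ x y → Sum.map return return (total x y)
        }
      ; _≟_  = λ x y → ¬¬? (x ≈ y)
      ; _≤?_ = λ x y → ¬¬? (x ≤ y)
      }
    ; 0≉1       = return 0≉1
    ; x*y≈0⇒y≈0 = λ x≉0 → ¬¬-map (cancel-0 (x≉0 ∘ return))
    ; +-mono-≤  = λ z → ¬¬-map (+-mono-≤ z)
    ; *-nonneg  = lift₂ *-nonneg
    }

  pow-stableRing : ∀ x n → pow stableRing x n ≡ pow commRing x n
  pow-stableRing x zero    = ≡.refl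
  pow-stableRing x (suc n) = ≡.cong (x *_) (pow-stableRing x n)

  sumFin-stableRing : ∀ n {f g : Fin n → Carrier} → (∀ i → f i ≡ g i) → sumFin stableRing n f ≡ sumFin commRing n g
  sumFin-stableRing zero    f≗g = ≡.refl
  sumFin-stableRing (suc n) f≗g = ≡.cong₂ _+_ (f≗g zero) (sumFin-stableRing n (f≗g ∘ suc))

-- Transfer to the reals through double negation.

open import Data.Nat using (_≤_; _*_; _+_)

theorem16 : ∀ {c ℓ} (ℝ : RealField c ℓ) →
    let module R = RealField ℝ in
    (d k : ℕ) (xs α : Fin k → R.Carrier) →
    (∀ i j → xs i R.≈ xs j → i ≡ j) →
    (∀ i → ¬ (α i R.≈ R.0#)) →
    4 * k ≤ d + 2 →
    (l : ℕ) (β ys : Fin l → R.Carrier) (e : Fin l → ℕ) →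
    (∀ x → sumFin R.commRing k (λ i → α i R.* pow R.commRing (x R.+ xs i) d)
    R.≈ sumFin R.commRing l (λ i → β i R.* pow R.commRing (x R.+ ys i) (e i))) →
    k ≤ l
theorem16 ℝ d k xs α xs-injective α≉0 4k≤d+2 l β ys e H =
  lower-bound d k xs α
    -- Equality of indices is decidable, so the double negation on the equality of nodes can be
    -- discharged.
    (λ i j xᵢ≈xⱼ → decidable-stable (i Finₚ.≟ j) (¬¬-map (xs-injective i j) xᵢ≈xⱼ))
    (return ∘ α≉0) 4k≤d+2 l β ys e
    -- The two rings share their operations, but `pow` and `sumFin` recurse with the ring as a
    -- parameter, so their agreement is proved by induction and transported.
    λ x → ≡.subst₂ (λ a b → ¬ ¬ (a ≈ b))
      (≡.sym (sumFin-stableRing k λ i → ≡.cong (α i ·_) (pow-stableRing _ d)))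
      (≡.sym (sumFin-stableRing l λ i → ≡.cong (β i ·_) (pow-stableRing _ (e i))))
      (return (H x))
  where
  open DoubleNegation ℝ
  open ShiftedPowers domain using (lower-bound)
  open RealField ℝ using (_≈_) renaming (_*_ to _·_)
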